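{- Every formula of the fixpoint language $\mathcal L^{\mathsf{XCGA}}_\mu$ is bisimulation invariant: for every concurrent game model $\mathcal M$, every $\mathsf{TLCGA}$-bisimulation $\beta$ in $\mathcal M$, every formula $\varphi$ of $\mathcal L^{\mathsf{XCGA}}_\mu$, and all states $s_1,s_2$ with $s_1\,\beta\,s_2$: $\mathcal M,s_1\Vdash\varphi$ if and only if $\mathcal M,s_2\Vdash\varphi$.
   Context: **Models.** Fix a finite set $\mathsf{Agt}$ of agents and a set $\mathsf{AP}$ of atomic propositions; a coalition is any subset of $\mathsf{Agt}$. A concurrent game model is $\mathcal M=(S,\mathsf{Act},\mathfrak g,V)$ with $S,\mathsf{Act}\neq\emptyset$; $\mathfrak g$ assigns to each $w\in S$ a game form $(\mathsf{Act},\mathsf{act}_w,S,\mathsf{out}_w)$, where $\mathsf{act}_w(a)\subseteq\mathsf{Act}$ is non-empty for each agent $a$ and $\mathsf{out}_w:\prod_{a\in\mathsf{Agt}}\mathsf{act}_w(a)\to S$; and $V:\mathsf{AP}\to\mathcal P(S)$. An action profile at $w$ is an element of $\prod_a\mathsf{act}_w(a)$. For an action profile $\zeta$ at $w$ and a coalition $C$, $\mathsf{Out}[w,\zeta|_C]$ is the set of states $\mathsf{out}_w(\zeta')$ for action profiles $\zeta'$ at $w$ that agree with $\zeta$ on $C$. **Language $\mathcal L^{\mathsf{XCGA}}_\mu$.** $\varphi::=p\mid\top\mid\neg\varphi\mid(\varphi\wedge\varphi)\mid(\varphi\vee\varphi)\mid\langle\![\gamma]\!\rangle\mid\mu x.\varphi$,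 where $p\in\mathsf{AP}$, $\gamma$ is a map assigning to each coalition a path formula of the form $\mathsf X\psi$ ($\psi$ a formula of the language), and in $\mu x.\varphi$ the propositional variable $x$ (an element of $\mathsf{AP}$) occurs only positively in $\varphi$ (under an even number of negations). **Semantics.** Booleans and atoms as usual. $\mathcal M,s\Vdash\langle\![\gamma]\!\rangle$ iff there is a strategy profile guaranteeing each coalition's goal; for nexttime goals this means: there is an action profile $\zeta$ at $s$ such that for every coalition $C$ with $\gamma(C)=\mathsf X\psi$, every state in $\mathsf{Out}[s,\zeta|_C]$ satisfies $\psi$. The extension of $\mu z.\varphi(z)$ in $\mathcal M$ is $\bigcap\{Z\subseteq S\mid [\![\varphi(Z)]\!]\subseteq Z\}$, where $[\![\varphi(Z)]\!]$ is the set of states satisfying $\varphi$ when the valuation is changed to map $z$ to $Z$. **Bisimulation.** A relation $\beta\subseteq S^2$ is a $\mathsf{TLCGA}$-bisimulation in $\mathcal M$ if whenever $s_1\beta s_2$: (Atom equivalence) for all $p\in\mathsf{AP}$, $s_1\in V(p)$ iff $s_2\in V(p)$; (Forth) for every action profile $\zeta^1$ at $s_1$ there is an action profile $\zeta^2$ at $s_2$ such that for every coalition $C$ and every $u_2\in\mathsf{Out}[s_2,\zeta^2|_C]$ there is $u_1\in\mathsf{Out}[s_1,\zeta^1|_C]$ with $u_1\beta u_2$; (Back) for every action profile $\zeta^2$ at $s_2$ there is an action profile $\zeta^1$ at $s_1$ such that for every coalition $C$ and every $u_1\in\mathsf{Out}[s_1,\zeta^1|_C]$ there is $u_2\in\mathsf{Out}[s_2,\zeta^2|_C]$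 with $u_1\beta u_2$. -}

module Defs where

open import Level using (Level; suc; Lift)
open import Data.Empty using (⊥)
open import Data.Fin.Base using (Fin)
open import Data.Fin.Subset using (Subset) renaming (_∈_ to _∈ᶜ_)
open import Data.Nat.Base using (ℕ)
open import Data.Parity.Base using (Parity; 0ℙ; 1ℙ; _⁻¹)
open import Data.Product.Base using (Σ; Σ-syntax; ∃-syntax; _×_; proj₁)
open import Data.Sum.Base using (_⊎_)
open import Data.Unit.Polymorphic.Base using (⊤)
open import Function.Bundles using (_⇔_)
open import Relation.Binary.Core using (Rel)
open import Relation.Binary.PropositionalEquality.Core using (_≡_; _≢_)
open import Relation.Nullary.Negation.Core using (¬_)
open import Relation.Unary using (Pred; _∈_; _⊆_; Satisfiable)

private
  variable
    ℓ : Level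

Agent : ℕ → Set
Agent n = Fin n

Coalition : ℕ → Set
Coalition n = Subset n

------------------------------------------------------------------------
-- Concurrent game models

record GameForm (n : ℕ) (Action State : Set ℓ) : Set (suc ℓ) where
  field
    act          : Agent n → Pred Action ℓ
    act-nonempty : ∀ a → Satisfiable (act a)

  ActionProfile : Set ℓ
  ActionProfile = (a : Agent n) → Σ Action (act a)

  -- Agreement compares only the actions: the proofs that they are
  -- available carry no content.
  AgreeOn : Coalition n → ActionProfile → ActionProfile → Set ℓ
  AgreeOn C ζ ζ′ = ∀ a → a ∈ᶜ C → proj₁ (ζ a) ≡ proj₁ (ζ′ a)

  field
    out      : ActionProfile → State
    -- out is a function of the actions chosen, neither of the proofs of
    -- their availability nor of the intensional identity of the profile.
    out-cong : ∀ ζ ζ′ → (∀ a → proj₁ (ζ a) ≡ proj₁ (ζ′ a)) → out ζ ≡ out ζ′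

  Out : ActionProfile → Coalition n → Pred State ℓ
  Out ζ C u = ∃[ ζ′ ] AgreeOn C ζ ζ′ × out ζ′ ≡ u

record Model (n : ℕ) (AP : Set ℓ) : Set (suc ℓ) where
  field
    State           : Set ℓ
    Action          : Set ℓ
    state-nonempty  : State
    action-nonempty : Action
    gameForm        : State → GameForm n Action State
    V               : AP → Pred State ℓ

  Profile : State → Set ℓ
  Profile w = GameForm.ActionProfile (gameForm w)

  Out[_,_∣_] : (w : State) → Profile w → Coalition n → Pred State ℓ
  Out[ w , ζ ∣ C ] = GameForm.Out (gameForm w) ζ C

------------------------------------------------------------------------
-- The language

-- Occurs x π φ: x has a free occurrence in φ under a number of negations
-- of parity π.  An occurrence bound by an inner μ x is not an occurrence
-- of the variable bound further out.

infix  8 ¬′_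
infixr 7 _∧′_
infixr 6 _∨′_

mutual

  data Formula (n : ℕ) (AP : Set ℓ) : Set ℓ where
    atom    : AP → Formula n AP
    ⊤′      : Formula n AP
    ¬′_     : Formula n AP → Formula n AP
    _∧′_    : Formula n AP → Formula n AP → Formula n AP
    _∨′_    : Formula n AP → Formula n AP → Formula n AP
    ⟨[_]⟩   : (Coalition n → PathFormula n AP) → Formula n AP
    μ       : (x : AP) (φ : Formula n AP) → OccursOnlyPositively x φ →
              Formula n AP

  data PathFormula (n : ℕ) (AP : Set ℓ) : Set ℓ where
    X : Formula n AP → PathFormula n AP

  Occurs : ∀ {n} {AP : Set ℓ} → AP → Parity → Formula n AP → Set ℓ
  Occurs x π (atom p)   = x ≡ p × π ≡ 0ℙ
  Occurs x π ⊤′         = Lift _ ⊥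
  Occurs x π (¬′ φ)     = Occurs x (π ⁻¹) φ
  Occurs x π (φ ∧′ ψ)   = Occurs x π φ ⊎ Occurs x π ψ
  Occurs x π (φ ∨′ ψ)   = Occurs x π φ ⊎ Occurs x π ψ
  Occurs x π ⟨[ γ ]⟩    = ∃[ C ] PathOccurs x π (γ C)
  Occurs x π (μ y φ _)  = x ≢ y × Occurs x π φ

  PathOccurs : ∀ {n} {AP : Set ℓ} → AP → Parity → PathFormula n AP → Set ℓ
  PathOccurs x π (X ψ) = Occurs x π ψ

  OccursOnlyPositively : ∀ {n} {AP : Set ℓ} → AP → Formula n AP → Set ℓ
  OccursOnlyPositively x φ = ¬ Occurs x 1ℙ φ

------------------------------------------------------------------------
-- Semantics

module Semantics {n : ℕ} {AP : Set ℓ} (M : Model n AP) where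
  open Model M hiding (V)

  Valuation : Set (suc ℓ)
  Valuation = AP → Pred State ℓ

  -- Stated so as not to need decidable equality on AP.
  _[_≔_] : Valuation → AP → Pred State ℓ → Valuation
  (V [ x ≔ Z ]) p s = (p ≡ x × s ∈ Z) ⊎ (p ≢ x × s ∈ V p)

  -- Subsets of State are predicates in Set ℓ.  Extensions quantify over
  -- them and so live one universe higher, uniformly in the formula; with
  -- excluded middle every predicate at either level is equivalent to one
  -- in Set ℓ, and the μ clause is the intersection of all pre-fixed points
  -- in the full powerset.
  mutual

    ⟦_⟧ : Formula n AP → Valuation → Pred State (suc ℓ)
    ⟦ atom p ⟧    V s = Lift (suc ℓ) (s ∈ V p)
    ⟦ ⊤′ ⟧        V s = ⊤
    ⟦ ¬′ φ ⟧      V s = ¬ (s ∈ ⟦ φ ⟧ V)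
    ⟦ φ ∧′ ψ ⟧    V s = s ∈ ⟦ φ ⟧ V × s ∈ ⟦ ψ ⟧ V
    ⟦ φ ∨′ ψ ⟧    V s = s ∈ ⟦ φ ⟧ V ⊎ s ∈ ⟦ ψ ⟧ V
    ⟦ ⟨[ γ ]⟩ ⟧   V s =
      Σ[ ζ ∈ Profile s ] (∀ C → Out[ s , ζ ∣ C ] ⊆ ⟦ γ C ⟧ᴳ V)
    ⟦ μ x φ _ ⟧   V s =
      (Z : Pred State ℓ) → ⟦ φ ⟧ (V [ x ≔ Z ]) ⊆ Z → s ∈ Z

    -- ⟦ X ψ ⟧ᴳ V is the set of successor states achieving the goal X ψ.
    ⟦_⟧ᴳ : PathFormula n AP → Valuation → Pred State (suc ℓ)
    ⟦ X ψ ⟧ᴳ V = ⟦ ψ ⟧ V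

infix 4 _,_⊩_

_,_⊩_ : ∀ {n} {AP : Set ℓ} (M : Model n AP) →
        Model.State M → Formula n AP → Set (suc ℓ)
M , s ⊩ φ = s ∈ Semantics.⟦_⟧ M φ (Model.V M)

------------------------------------------------------------------------
-- Bisimulation

record IsBisimulation {n : ℕ} {AP : Set ℓ} (M : Model n AP)
                      (β : Rel (Model.State M) ℓ) : Set ℓ where
  open Model M
  field
    atom-equivalence : ∀ {s₁ s₂} → β s₁ s₂ → ∀ p → s₁ ∈ V p ⇔ s₂ ∈ V p

    forth : ∀ {s₁ s₂} → β s₁ s₂ → (ζ₁ : Profile s₁) →
            Σ[ ζ₂ ∈ Profile s₂ ]
              (∀ C u₂ → u₂ ∈ Out[ s₂ , ζ₂ ∣ C ] →
               ∃[ u₁ ] u₁ ∈ Out[ s₁ , ζ₁ ∣ C ] × β u₁ u₂)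

    back  : ∀ {s₁ s₂} → β s₁ s₂ → (ζ₂ : Profile s₂) →
            Σ[ ζ₁ ∈ Profile s₁ ]
              (∀ C u₁ → u₁ ∈ Out[ s₁ , ζ₁ ∣ C ] →
               ∃[ u₂ ] u₂ ∈ Out[ s₂ , ζ₂ ∣ C ] × β u₁ u₂)

{-# OPTIONS --safe #-}

-- Knaster–Tarski without ordinals: if Z is a pre-fixed point of φ, so is its
-- invariant kernel, the set of states all of whose β-equivalent states lie
-- in Z.  The kernel is β-invariant, so the induction hypothesis for φ applies
-- to it, and monotonicity of φ brings the result back to Z.  Hence a state in
-- all pre-fixed points is in all their kernels, which are closed under β.

module Submission where

open import Defs
open import Level using (Level; lift)
open import Data.Nat.Base using (ℕ)
open import Data.Parity.Base using (Parity; 0ℙ; 1ℙ)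
open import Data.Product.Base using (_,_; map₂)
open import Data.Product.Function.NonDependent.Propositional using (_×-⇔_)
open import Data.Sum.Base using (inj₁; inj₂)
import Data.Sum.Base as Sum
open import Data.Sum.Function.Propositional using (_⊎-⇔_)
open import Function.Base using (_∘_)
open import Function.Bundles using (_⇔_; mk⇔; module Equivalence)
open import Function.Properties.Equivalence using (⇔-isEquivalence)
open import Function.Related.TypeIsomorphisms using (¬-cong-⇔)
open import Relation.Binary.Construct.Closure.Equivalence
  using (EqClosure; gfold; reflexive; symmetric; transitive; return)
open import Relation.Binary.Core using (Rel)
open import Relation.Binary.PropositionalEquality.Core using (refl)
open import Relation.Nullary.Negation.Core using (contradiction)
open import Relation.Unary using (Pred; _∈_; _⊆_)

open Equivalence using (to; from)

module Monotonicity {ℓ : Level} {n : ℕ} {AP : Set ℓ} (M : Model n AP) where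
  open Model M using (State)
  open Semantics M

  -- Keeping `Occ` abstract lets the comparison pass to subformulas, whose occurrences are among
  -- those of the whole formula.
  record _≼[_]_ (V : Valuation) (Occ : AP → Parity → Set ℓ)
                (W : Valuation) : Set ℓ where
    constructor _,ᵛ_
    field
      pos : ∀ {p} → Occ p 0ℙ → V p ⊆ W p
      neg : ∀ {p} → Occ p 1ℙ → W p ⊆ V p

  open _≼[_]_

  restrict : ∀ {V W} {Occ Occ′ : AP → Parity → Set ℓ} →
             (∀ {p π} → Occ′ p π → Occ p π) →
             V ≼[ Occ ] W → V ≼[ Occ′ ] W
  restrict f V≼W = (pos V≼W ∘ f) ,ᵛ (neg V≼W ∘ f)

  -- At `x` both sides have the value `Z`. Any other variable free in `φ` remains free under the
  -- binder, with the same parity.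
  ≼-≔ : ∀ {V W} x (φ : Formula n AP) x⁺ (Z : Pred State ℓ) →
        V ≼[ (λ p π → Occurs p π (μ x φ x⁺)) ] W →
        (V [ x ≔ Z ]) ≼[ (λ p π → Occurs p π φ) ] (W [ x ≔ Z ])
  ≼-≔ x φ _ Z V≼W =
    (λ o → Sum.map₂ λ (p≢x , s∈V) → p≢x , pos V≼W (p≢x , o) s∈V) ,ᵛ
    (λ o → Sum.map₂ λ (p≢x , s∈W) → p≢x , neg V≼W (p≢x , o) s∈W)

  mutual
    ⟦⟧-mono : ∀ φ {V W} → V ≼[ (λ p π → Occurs p π φ) ] W → ⟦ φ ⟧ V ⊆ ⟦ φ ⟧ W
    ⟦⟧-mono (atom p) V≼W (lift s∈V) = lift (pos V≼W (refl , refl) s∈V)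
    ⟦⟧-mono ⊤′       V≼W h          = h
    -- Negation flips every parity, so swapping the two fields compares `W` with `V` on `φ`.
    ⟦⟧-mono (¬′ φ)   V≼W h          = h ∘ ⟦⟧-mono φ (neg V≼W ,ᵛ pos V≼W)
    ⟦⟧-mono (φ ∧′ ψ) V≼W (h , k)    =
      ⟦⟧-mono φ (restrict inj₁ V≼W) h , ⟦⟧-mono ψ (restrict inj₂ V≼W) k
    ⟦⟧-mono (φ ∨′ ψ) V≼W h          =
      Sum.map (⟦⟧-mono φ (restrict inj₁ V≼W)) (⟦⟧-mono ψ (restrict inj₂ V≼W)) h
    ⟦⟧-mono ⟨[ γ ]⟩  V≼W (ζ , h)    =
      ζ , λ C u∈Out → ⟦⟧ᴳ-mono (γ C) (restrict (C ,_) V≼W) (h C u∈Out)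
    -- A pre-fixed point under `W` is one under `V`, so `h` applies to it.
    ⟦⟧-mono (μ x φ x⁺) V≼W h Z pre  =
      h Z (pre ∘ ⟦⟧-mono φ (≼-≔ x φ x⁺ Z V≼W))

    ⟦⟧ᴳ-mono : ∀ g {V W} → V ≼[ (λ p π → PathOccurs p π g) ] W →
               ⟦ g ⟧ᴳ V ⊆ ⟦ g ⟧ᴳ W
    ⟦⟧ᴳ-mono (X ψ) = ⟦⟧-mono ψ

  ≔-mono : ∀ {x} φ → OccursOnlyPositively x φ → ∀ V {Y Z : Pred State ℓ} →
           Y ⊆ Z → ⟦ φ ⟧ (V [ x ≔ Y ]) ⊆ ⟦ φ ⟧ (V [ x ≔ Z ])
  ≔-mono φ x⁺ V Y⊆Z = ⟦⟧-mono φ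
    ((λ _ → Sum.map₁ λ (p≡x , s∈Y) → p≡x , Y⊆Z s∈Y) ,ᵛ
     (λ { o (inj₁ (refl , _)) → contradiction o x⁺
        ; o (inj₂ s∈V)        → inj₂ s∈V }))

module Invariance {ℓ : Level} {n : ℕ} {AP : Set ℓ} (M : Model n AP)
                  (β : Rel (Model.State M) ℓ) (bis : IsBisimulation M β) where
  open Model M using (State)
  open Semantics M
  open Monotonicity M using (≔-mono)
  open IsBisimulation bis

  Invariant : ∀ {a} → Pred State a → Set _
  Invariant P = ∀ {s t} → β s t → s ∈ P ⇔ t ∈ P

  -- Logical equivalence is an equivalence relation, so it extends from `β` to the closure.
  invariant-closure : ∀ {a} {P : Pred State a} → Invariant P →
                      ∀ {s t} → EqClosure β s t → s ∈ P ⇔ t ∈ P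
  invariant-closure {P = P} = gfold ⇔-isEquivalence P

  -- The largest invariant subset of `Z`. It stays in `Set ℓ`, so the `μ` clause can be instantiated
  -- with it.
  kernel : Pred State ℓ → Pred State ℓ
  kernel Z s = ∀ t → EqClosure β s t → t ∈ Z

  kernel⊆ : ∀ Z → kernel Z ⊆ Z
  kernel⊆ Z k = k _ (reflexive β)

  kernel-invariant : ∀ Z → Invariant (kernel Z)
  kernel-invariant Z b = mk⇔
    (λ k u t∼u → k u (transitive β (return b) t∼u))
    (λ k u s∼u → k u (transitive β (symmetric β (return b)) s∼u))

  ≔-invariant : ∀ {V x} {Z : Pred State ℓ} → (∀ p → Invariant (V p)) →
                Invariant Z → ∀ p → Invariant ((V [ x ≔ Z ]) p)
  ≔-invariant V-inv Z-inv p b = mk⇔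
    (Sum.map (map₂ (to (Z-inv b))) (map₂ (to (V-inv p b))))
    (Sum.map (map₂ (from (Z-inv b))) (map₂ (from (V-inv p b))))

  kernel-prefixed : ∀ {x} φ → OccursOnlyPositively x φ → ∀ V Z →
                    Invariant (⟦ φ ⟧ (V [ x ≔ kernel Z ])) →
                    ⟦ φ ⟧ (V [ x ≔ Z ]) ⊆ Z →
                    ⟦ φ ⟧ (V [ x ≔ kernel Z ]) ⊆ kernel Z
  kernel-prefixed φ x⁺ V Z φ-inv pre h t s∼t =
    pre (≔-mono φ x⁺ V (kernel⊆ Z) (to (invariant-closure φ-inv s∼t) h))

  mutual
    -- The valuation is arbitrary because the `μ` case uses the induction hypothesis at an updated
    -- one.
    ⟦⟧-invariant : ∀ φ {V} → (∀ p → Invariant (V p)) → Invariant (⟦ φ ⟧ V)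
    ⟦⟧-invariant (atom p) V-inv b = mk⇔
      (λ (lift h) → lift (to (V-inv p b) h))
      (λ (lift h) → lift (from (V-inv p b) h))
    ⟦⟧-invariant ⊤′       V-inv b = mk⇔ _ _
    ⟦⟧-invariant (¬′ φ)   V-inv b = ¬-cong-⇔ (⟦⟧-invariant φ V-inv b)
    ⟦⟧-invariant (φ ∧′ ψ) V-inv b =
      ⟦⟧-invariant φ V-inv b ×-⇔ ⟦⟧-invariant ψ V-inv b
    ⟦⟧-invariant (φ ∨′ ψ) V-inv b =
      ⟦⟧-invariant φ V-inv b ⊎-⇔ ⟦⟧-invariant ψ V-inv b
    ⟦⟧-invariant ⟨[ γ ]⟩  V-inv b = mk⇔
      -- Outcomes are matched backwards: each one at the second state has a partner at the first,
      -- where the goal holds by `h`.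
      (λ (ζ₁ , h) → let ζ₂ , match = forth b ζ₁ in
        ζ₂ , λ C {u₂} u₂∈Out → let u₁ , u₁∈Out , b′ = match C u₂ u₂∈Out in
          to (⟦⟧ᴳ-invariant (γ C) V-inv b′) (h C u₁∈Out))
      (λ (ζ₂ , h) → let ζ₁ , match = back b ζ₂ in
        ζ₁ , λ C {u₁} u₁∈Out → let u₂ , u₂∈Out , b′ = match C u₁ u₁∈Out in
          from (⟦⟧ᴳ-invariant (γ C) V-inv b′) (h C u₂∈Out))
    ⟦⟧-invariant (μ x φ x⁺) {V} V-inv b =
      mk⇔ (transfer (return b)) (transfer (symmetric β (return b)))
      where
      transfer : ∀ {s t} → EqClosure β s t →
                 s ∈ ⟦ μ x φ x⁺ ⟧ V → t ∈ ⟦ μ x φ x⁺ ⟧ V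
      -- Membership of `s` in the kernel is a statement about its whole class; applied to `s∼t` it
      -- yields membership of `t` in `Z`.
      transfer s∼t h Z pre = h (kernel Z)
        (kernel-prefixed φ x⁺ V Z
          (⟦⟧-invariant φ (≔-invariant V-inv (kernel-invariant Z))) pre)
        _ s∼t

    ⟦⟧ᴳ-invariant : ∀ g {V} → (∀ p → Invariant (V p)) → Invariant (⟦ g ⟧ᴳ V)
    ⟦⟧ᴳ-invariant (X ψ) = ⟦⟧-invariant ψ

theorem3 : {ℓ : Level} (n : ℕ) (AP : Set ℓ) (M : Model n AP)
    (β : Rel (Model.State M) ℓ) → IsBisimulation M β →
    (φ : Formula n AP) (s₁ s₂ : Model.State M) → β s₁ s₂ →
    (M , s₁ ⊩ φ) ⇔ (M , s₂ ⊩ φ)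
theorem3 n AP M β bis φ s₁ s₂ b =
  Invariance.⟦⟧-invariant M β bis φ (λ p b′ → atom-equivalence b′ p) b
  where open IsBisimulation bis
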